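{- Let $f\colon\{0,1\}^n\to\{0,1\}$ be a Boolean function. Then \[\mathsf{depth}^{\mathsf u}(f)=\mathsf{CC}(\mathsf{KW}^{\mathsf u}_f)\quad\text{and}\quad \mathsf{size}^{\mathsf u}(f)=\mathsf{monorect}(\mathsf{KW}^{\mathsf u}_f).\]
   Context: **Three-valued logic.** Let $\mathsf u$ be a third symbol, thought of as $\tfrac12$, so $0<\mathsf u<1$. On $\{0,\mathsf u,1\}$ put $x\wedge y=\min(x,y)$, $x\vee y=\max(x,y)$, $\neg x=1-x$ (so $\neg\mathsf u=\mathsf u$). A resolution of $\alpha\in\{0,\mathsf u,1\}^n$ is a string $a\in\{0,1\}^n$ with $a_i=\alpha_i$ whenever $\alpha_i\ne\mathsf u$. The hazard-free extension $\tilde f\colon\{0,\mathsf u,1\}^n\to\{0,\mathsf u,1\}$ of $f\colon\{0,1\}^n\to\{0,1\}$ is: $\tilde f(\alpha)=c\in\{0,1\}$ if $f(a)=c$ for all resolutions $a$ of $\alpha$, and $\tilde f(\alpha)=\mathsf u$ otherwise. **Formulas.** A De Morgan formula is a binary tree whose internal nodes are labeled $\vee$ or $\wedge$ (fan-in two) and whose leaves are labeled by literals $x_i$ or $\neg x_i$; it is evaluated on inputs in $\{0,\mathsf u,1\}^n$ by the rules above. Its size is its number of leaves and its depth is the length of the longest root-to-leaf path. A formula $F$ computing $f$ is hazard-free if $F(\alpha)=\tilde f(\alpha)$ for all $\alpha\in\{0,\mathsf u,1\}^n$. $\mathsf{size}^{\mathsf u}(f)$ and $\mathsf{depth}^{\mathsf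 u}(f)$ are the minimal size and the minimal depth of a hazard-free De Morgan formula computing $f$. **Communication.** For a search problem $K$ assigning to each $(\alpha,\beta)\in A\times B$ a nonempty set $K(\alpha,\beta)$ of valid answers, Alice gets $\alpha$, Bob gets $\beta$, and they must agree on an element of $K(\alpha,\beta)$ by a deterministic protocol (a binary tree, each internal node owned by Alice or Bob, who sends one bit depending on their own input; each leaf carries an answer that must be valid for all inputs reaching it). $\mathsf{CC}(K)$ is the minimum over protocols solving $K$ of the maximum number of bits exchanged; $\mathsf{monorect}(K)$ is the minimum number of leaves of a protocol solving $K$. **The game.** In the hazard-free Karchmer–Wigderson game $\mathsf{KW}^{\mathsf u}_f$, Alice gets $\alpha\in\{0,\mathsf u,1\}^n$ with $\tilde f(\alpha)=1$, Bob gets $\beta\in\{0,\mathsf u,1\}^n$ with $\tilde f(\beta)=0$, and the valid answers are the $i\in[n]$ with $\alpha_i\ne\beta_i$, $\alpha_i\neq\mathsf u$ and $\beta_i\ne\mathsf u$.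
   Formalization: The function f is assumed non-constant: for constant f no formula with only literal leaves is hazard-free (it gives u on the all-u input), so size^u(f) and depth^u(f) are undefined. -}

module Defs where

open import Data.Bool using (Bool; true; false; if_then_else_)
import Data.Bool.Properties as Bool
open import Data.Fin using (Fin)
open import Data.Fin.Properties using (all?; any?)
open import Data.Fin.Subset.Properties using (anySubset?)
open import Data.Nat using (ℕ; suc; _+_; _⊔_; _≤_)
open import Data.Product using (∃-syntax; _×_; _,_)
open import Data.Vec using (Vec; lookup; map; tabulate)
open import Data.Vec.Properties using (lookup∘tabulate)
open import Relation.Binary.Definitions using (DecidableEquality)
open import Relation.Binary.PropositionalEquality
  using (_≡_; _≢_; refl; sym; trans; cong)
open import Relation.Nullary
  using (¬_; Dec; yes; no; ¬?; _×-dec_; _→-dec_; contradiction)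
open import Relation.Nullary.Decidable using (map′; decidable-stable)

private
  variable
    n : ℕ

-- Relations rather than functions: a set of naturals has at most one
-- minimum and at most one maximum, but may have neither.

IsMinimum : (ℕ → Set) → ℕ → Set
IsMinimum P m = P m × (∀ k → P k → m ≤ k)

IsMaximum : (ℕ → Set) → ℕ → Set
IsMaximum P m = P m × (∀ k → P k → k ≤ m)

data Trit : Set where
  𝟘 𝐮 𝟙 : Trit

infix  8 ~_
infixr 7 _⊓ᵗ_
infixr 6 _⊔ᵗ_

-- Minimum, maximum and x ↦ 1 - x for the order 𝟘 < 𝐮 < 𝟙, 𝐮 being ½.

_⊓ᵗ_ : Trit → Trit → Trit
𝟘 ⊓ᵗ _ = 𝟘
𝟙 ⊓ᵗ y = y
𝐮 ⊓ᵗ 𝟘 = 𝟘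
𝐮 ⊓ᵗ 𝐮 = 𝐮
𝐮 ⊓ᵗ 𝟙 = 𝐮

_⊔ᵗ_ : Trit → Trit → Trit
𝟙 ⊔ᵗ _ = 𝟙
𝟘 ⊔ᵗ y = y
𝐮 ⊔ᵗ 𝟘 = 𝐮
𝐮 ⊔ᵗ 𝐮 = 𝐮
𝐮 ⊔ᵗ 𝟙 = 𝟙

~_ : Trit → Trit
~ 𝟘 = 𝟙
~ 𝐮 = 𝐮
~ 𝟙 = 𝟘

_≟ᵗ_ : DecidableEquality Trit
𝟘 ≟ᵗ 𝟘 = yes refl
𝟘 ≟ᵗ 𝐮 = no λ ()
𝟘 ≟ᵗ 𝟙 = no λ ()
𝐮 ≟ᵗ 𝟘 = no λ ()
𝐮 ≟ᵗ 𝐮 = yes refl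
𝐮 ≟ᵗ 𝟙 = no λ ()
𝟙 ≟ᵗ 𝟘 = no λ ()
𝟙 ≟ᵗ 𝐮 = no λ ()
𝟙 ≟ᵗ 𝟙 = yes refl

⌜_⌝ : Bool → Trit
⌜ false ⌝ = 𝟘
⌜ true  ⌝ = 𝟙

BoolFun : ℕ → Set
BoolFun n = Vec Bool n → Bool

-- With only literals as leaves, every formula takes the value 𝐮 when all
-- inputs are 𝐮, so a constant function has no hazard-free formula.
NonConstant : BoolFun n → Set
NonConstant f = (∃[ a ] f a ≡ true) × (∃[ b ] f b ≡ false)

_ResolutionOf_ : Vec Bool n → Vec Trit n → Set
a ResolutionOf α = ∀ i → lookup α i ≢ 𝐮 → ⌜ lookup a i ⌝ ≡ lookup α i

_resolutionOf?_ : (a : Vec Bool n) (α : Vec Trit n) → Dec (a ResolutionOf α)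
a resolutionOf? α = all? λ i →
  ¬? (lookup α i ≟ᵗ 𝐮) →-dec (⌜ lookup a i ⌝ ≟ᵗ lookup α i)

ConstantOn : BoolFun n → Vec Trit n → Bool → Set
ConstantOn f α c = ∀ a → a ResolutionOf α → f a ≡ c

-- Subset n is Vec Bool n, so anySubset? searches all Boolean strings.
constantOn? : (f : BoolFun n) (α : Vec Trit n) (c : Bool) →
              Dec (ConstantOn f α c)
constantOn? f α c = map′
  (λ none a r → decidable-stable (f a Bool.≟ c) λ f≢c → none (a , r , f≢c))
  (λ const (a , r , f≢c) → f≢c (const a r))
  (¬? (anySubset? λ a → (a resolutionOf? α) ×-dec ¬? (f a Bool.≟ c)))

extValue : {P Q : Set} → Dec P → Dec Q → Trit
extValue (yes _) _       = 𝟙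
extValue (no _)  (yes _) = 𝟘
extValue (no _)  (no _)  = 𝐮

-- Every α has a resolution, so at most one of the two tests succeeds.
hazardFreeExt : BoolFun n → Vec Trit n → Trit
hazardFreeExt f α = extValue (constantOn? f α true) (constantOn? f α false)

data Formula (n : ℕ) : Set where
  var  : Fin n → Formula n
  ¬var : Fin n → Formula n
  _∧_  : Formula n → Formula n → Formula n
  _∨_  : Formula n → Formula n → Formula n

eval : Formula n → Vec Trit n → Trit
eval (var i)  α = lookup α i
eval (¬var i) α = ~ lookup α i
eval (F ∧ G)  α = eval F α ⊓ᵗ eval G α
eval (F ∨ G)  α = eval F α ⊔ᵗ eval G α

size : Formula n → ℕ
size (var _)  = 1
size (¬var _) = 1
size (F ∧ G)  = size F + size G
size (F ∨ G)  = size F + size G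

depth : Formula n → ℕ
depth (var _)  = 0
depth (¬var _) = 0
depth (F ∧ G)  = suc (depth F ⊔ depth G)
depth (F ∨ G)  = suc (depth F ⊔ depth G)

_Computes_ : Formula n → BoolFun n → Set
F Computes f = ∀ a → eval F (map ⌜_⌝ a) ≡ ⌜ f a ⌝

_HazardFreeFor_ : Formula n → BoolFun n → Set
F HazardFreeFor f = F Computes f × (∀ α → eval F α ≡ hazardFreeExt f α)

IsSizeᵘ : BoolFun n → ℕ → Set
IsSizeᵘ f = IsMinimum λ s → ∃[ F ] F HazardFreeFor f × size F ≡ s

IsDepthᵘ : BoolFun n → ℕ → Set
IsDepthᵘ f = IsMinimum λ d → ∃[ F ] F HazardFreeFor f × depth F ≡ d

record SearchProblem : Set₁ where
  field
    AliceInput : Set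
    BobInput   : Set
    Answer     : Set
    Valid      : AliceInput → BobInput → Answer → Set
    nonempty   : ∀ x y → ∃[ o ] Valid x y o

-- A node carries the owner's message function, the subtree taken after
-- the bit false, and the subtree taken after the bit true.
data Protocol (A B O : Set) : Set where
  leaf  : O → Protocol A B O
  alice : (A → Bool) → Protocol A B O → Protocol A B O → Protocol A B O
  bob   : (B → Bool) → Protocol A B O → Protocol A B O → Protocol A B O

module _ {A B O : Set} where

  output : Protocol A B O → A → B → O
  output (leaf o)      x y = o
  output (alice m Π Ρ) x y = if m x then output Ρ x y else output Π x y
  output (bob m Π Ρ)   x y = if m y then output Ρ x y else output Π x y

  bits : Protocol A B O → A → B → ℕ
  bits (leaf o)      x y = 0
  bits (alice m Π Ρ) x y = suc (if m x then bits Ρ x y else bits Π x y)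
  bits (bob m Π Ρ)   x y = suc (if m y then bits Ρ x y else bits Π x y)

  leaves : Protocol A B O → ℕ
  leaves (leaf o)      = 1
  leaves (alice m Π Ρ) = leaves Π + leaves Ρ
  leaves (bob m Π Ρ)   = leaves Π + leaves Ρ

  IsCost : Protocol A B O → ℕ → Set
  IsCost Π = IsMaximum λ k → ∃[ x ] ∃[ y ] bits Π x y ≡ k

module _ (K : SearchProblem) where
  open SearchProblem K

  Solves : Protocol AliceInput BobInput Answer → Set
  Solves Π = ∀ x y → Valid x y (output Π x y)

  IsCC : ℕ → Set
  IsCC = IsMinimum λ c → ∃[ Π ] Solves Π × IsCost Π c

  IsMonorect : ℕ → Set
  IsMonorect = IsMinimum λ l → ∃[ Π ] Solves Π × leaves Π ≡ l

Separates : Vec Trit n → Vec Trit n → Fin n → Set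
Separates α β i =
  lookup α i ≢ lookup β i × lookup α i ≢ 𝐮 × lookup β i ≢ 𝐮

separates? : (α β : Vec Trit n) (i : Fin n) → Dec (Separates α β i)
separates? α β i =
  ¬? (lookup α i ≟ᵗ lookup β i) ×-dec
  (¬? (lookup α i ≟ᵗ 𝐮) ×-dec ¬? (lookup β i ≟ᵗ 𝐮))

extValue≡𝟙 : {P Q : Set} (p? : Dec P) (q? : Dec Q) → extValue p? q? ≡ 𝟙 → P
extValue≡𝟙 (yes p) _       _ = p
extValue≡𝟙 (no _)  (yes _) ()
extValue≡𝟙 (no _)  (no _)  ()

extValue≡𝟘 : {P Q : Set} (p? : Dec P) (q? : Dec Q) → extValue p? q? ≡ 𝟘 → Q
extValue≡𝟘 (yes _) _       ()
extValue≡𝟘 (no _)  (yes q) _ = q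
extValue≡𝟘 (no _)  (no _)  ()

ext≡𝟙⇒constant : (f : BoolFun n) (α : Vec Trit n) →
                 hazardFreeExt f α ≡ 𝟙 → ConstantOn f α true
ext≡𝟙⇒constant f α = extValue≡𝟙 (constantOn? f α true) (constantOn? f α false)

ext≡𝟘⇒constant : (f : BoolFun n) (α : Vec Trit n) →
                 hazardFreeExt f α ≡ 𝟘 → ConstantOn f α false
ext≡𝟘⇒constant f α = extValue≡𝟘 (constantOn? f α true) (constantOn? f α false)

private
  merge : Trit → Trit → Bool
  merge 𝟘 _ = false
  merge 𝟙 _ = true
  merge 𝐮 𝟙 = true
  merge 𝐮 𝐮 = false
  merge 𝐮 𝟘 = false

  mergeˡ : ∀ s t → s ≢ 𝐮 → ⌜ merge s t ⌝ ≡ s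
  mergeˡ 𝟘 t s≢u = refl
  mergeˡ 𝐮 t s≢u = contradiction refl s≢u
  mergeˡ 𝟙 t s≢u = refl

  mergeʳ : ∀ s t → ¬ (s ≢ t × s ≢ 𝐮 × t ≢ 𝐮) → t ≢ 𝐮 → ⌜ merge s t ⌝ ≡ t
  mergeʳ 𝐮 𝟘 ¬sep t≢u = refl
  mergeʳ 𝐮 𝐮 ¬sep t≢u = contradiction refl t≢u
  mergeʳ 𝐮 𝟙 ¬sep t≢u = refl
  mergeʳ 𝟘 t ¬sep t≢u =
    decidable-stable (𝟘 ≟ᵗ t) λ s≢t → ¬sep (s≢t , (λ ()) , t≢u)
  mergeʳ 𝟙 t ¬sep t≢u =
    decidable-stable (𝟙 ≟ᵗ t) λ s≢t → ¬sep (s≢t , (λ ()) , t≢u)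

-- If no position separated α from β, they would have a common resolution.
separated : (f : BoolFun n) (α β : Vec Trit n) →
            hazardFreeExt f α ≡ 𝟙 → hazardFreeExt f β ≡ 𝟘 →
            ∃[ i ] Separates α β i
separated {n} f α β fα≡𝟙 fβ≡𝟘 = decidable-stable (any? (separates? α β)) λ none →
  let
    a : Vec Bool n
    a = tabulate λ i → merge (lookup α i) (lookup β i)

    a≡ : ∀ i → ⌜ lookup a i ⌝ ≡ ⌜ merge (lookup α i) (lookup β i) ⌝
    a≡ i = cong ⌜_⌝ (lookup∘tabulate _ i)

    f≡true : f a ≡ true
    f≡true = ext≡𝟙⇒constant f α fα≡𝟙 a λ i α≢u →
      trans (a≡ i) (mergeˡ (lookup α i) (lookup β i) α≢u)

    f≡false : f a ≡ false
    f≡false = ext≡𝟘⇒constant f β fβ≡𝟘 a λ i β≢u →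
      trans (a≡ i) (mergeʳ (lookup α i) (lookup β i) (λ s → none (i , s)) β≢u)
  in contradiction (trans (sym f≡true) f≡false) λ ()

KWᵘ : BoolFun n → SearchProblem
KWᵘ {n} f = record
  { AliceInput = ∃[ α ] hazardFreeExt f α ≡ 𝟙
  ; BobInput   = ∃[ β ] hazardFreeExt f β ≡ 𝟘
  ; Answer     = Fin n
  ; Valid      = λ (α , _) (β , _) → Separates α β
  ; nonempty   = λ (α , p) (β , q) → separated f α β p q
  }

{-# OPTIONS --safe #-}

-- A formula that is 1 on all of Alice's inputs and 0 on all of Bob's is
-- automatically hazard-free: evaluation is monotone in the information order,
-- so a Boolean value at α forces f to be constant on the resolutions of α.
-- Hence hazard-free formulas are exactly the formulas separating the two input
-- sets, and these correspond to protocols in the usual Karchmer–Wigderson way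
-- (∨ for Alice's nodes, ∧ for Bob's).  CC only counts the bits of transcripts
-- that occur, so nodes with a branch that is never taken are pruned on the way
-- from protocols to formulas.  The minima exist because hazard-freeness is
-- decidable and there are finitely many formulas of each depth.
module Submission where

open import Defs

open import Axiom.UniquenessOfIdentityProofs using (module Decidable⇒UIP)
open import Data.Bool using (Bool; true; false)
import Data.Bool.Properties as Bool
open import Data.Fin using (Fin)
open import Data.List as List using (List; []; _∷_; _++_; allFin; cartesianProductWith)
open import Data.List.Membership.Propositional using (_∈_; lose)
open import Data.List.Membership.Propositional.Properties
  using (∈-++⁺ˡ; ∈-++⁺ʳ; ∈-map⁺; ∈-allFin; ∈-cartesianProductWith⁺; ∈-concatMap⁺)
open import Data.List.Relation.Unary.All as All using (All)
open import Data.List.Relation.Unary.Any as Any using (here; there)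
open import Data.Nat using (ℕ; zero; suc; _+_; _⊔_; _≤_; _<_; pred; z≤n; s≤s; _≟_)
open import Data.Nat.Induction using (<-rec)
open import Data.Nat.Properties
open import Data.Product using (∃; ∃₂; ∃-syntax; _×_; _,_; proj₁; proj₂; map₂)
open import Data.Sum using (inj₁; inj₂; [_,_]′)
open import Data.Unit using (tt)
open import Data.Vec as Vec using (Vec; []; _∷_; lookup)
open import Data.Vec.Properties using (lookup-map)
open import Data.Vec.Relation.Binary.Pointwise.Extensional using (ext; Pointwise-≡⇒≡)
open import Function using (_∘_; id)
open import Relation.Binary.PropositionalEquality
  using (_≡_; _≢_; refl; sym; trans; cong; cong₂; subst; module ≡-Reasoning)
open import Relation.Nullary
open import Relation.Nullary.Decidable using (map′; decidable-stable)
open import Relation.Unary using (Decidable; U; _⊆_; _∪_; _∩_)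
open import Relation.Unary.Properties using (U?)

private
  variable
    n : ℕ

-- Least numbers and search through finite lists.

least : {P : ℕ → Set} → Decidable P → ∃ P → ∃ (IsMinimum P)
least {P} P? (k , pk) = <-rec (λ k → P k → ∃ (IsMinimum P)) step k pk
  where
  step : ∀ k → (∀ {j} → j < k → P j → ∃ (IsMinimum P)) → P k → ∃ (IsMinimum P)
  step k rec pk with anyUpTo? P? k
  ... | yes (j , j<k , pj) = rec j<k pj
  ... | no none = k , pk , λ j pj → ≮⇒≥ λ j<k → none (j , j<k , pj)

-- Truncated subtraction makes the claim false at `d = 0`; the bound `k < d` excludes that value.
≰pred : ∀ {k d} → k < d → ¬ d ≤ pred d
≰pred (s≤s _) = 1+n≰n

module _ {A : Set} {xs : List A} (complete : ∀ x → x ∈ xs) where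

  searchable : {P : A → Set} → Decidable P → Dec (∃ P)
  searchable P? = map′ Any.satisfied (λ (x , px) → lose (complete x) px) (Any.any? P? xs)

  checkable : {P : A → Set} → Decidable P → Dec (∀ x → P x)
  checkable P? = map′ (λ ps x → All.lookup ps (complete x)) (λ p → All.tabulate λ {x} _ → p x)
                      (All.all? P? xs)

-- Three-valued connectives and the information order.

⌜⌝-injective : ∀ {b c} → ⌜ b ⌝ ≡ ⌜ c ⌝ → b ≡ c
⌜⌝-injective {false} {false} _ = refl
⌜⌝-injective {true}  {true}  _ = refl

⌜⌝≢𝐮 : ∀ b → ⌜ b ⌝ ≢ 𝐮
⌜⌝≢𝐮 false ()
⌜⌝≢𝐮 true  ()

-- The information order with the more determined value on the left: `𝐮` is the top, and `𝟘` and `𝟙`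
-- are incomparable. Passing to a resolution moves every coordinate down in it.
_⊑_ : Trit → Trit → Set
t ⊑ s = s ≢ 𝐮 → t ≡ s

⊓ᵗ-zeroʳ : ∀ t → t ⊓ᵗ 𝟘 ≡ 𝟘
⊓ᵗ-zeroʳ 𝟘 = refl
⊓ᵗ-zeroʳ 𝐮 = refl
⊓ᵗ-zeroʳ 𝟙 = refl

⊔ᵗ-zeroʳ : ∀ t → t ⊔ᵗ 𝟙 ≡ 𝟙
⊔ᵗ-zeroʳ 𝟘 = refl
⊔ᵗ-zeroʳ 𝐮 = refl
⊔ᵗ-zeroʳ 𝟙 = refl

~-mono : ∀ {t s} → t ⊑ s → (~ t) ⊑ (~ s)
~-mono {s = s} t⊑s ~s≢𝐮 = cong ~_ (t⊑s (~s≢𝐮 ∘ cong ~_))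

⊓-mono : ∀ {t t′} s s′ → t ⊑ s → t′ ⊑ s′ → (t ⊓ᵗ t′) ⊑ (s ⊓ᵗ s′)
⊓-mono 𝟘 s′ p q _ = cong (_⊓ᵗ _) (p λ ())
⊓-mono 𝟙 s′ p q r = cong₂ _⊓ᵗ_ (p λ ()) (q r)
⊓-mono {t} 𝐮 𝟘 p q _ = trans (cong (t ⊓ᵗ_) (q λ ())) (⊓ᵗ-zeroʳ t)
⊓-mono 𝐮 𝐮 p q r = contradiction refl r
⊓-mono 𝐮 𝟙 p q r = contradiction refl r

⊔-mono : ∀ {t t′} s s′ → t ⊑ s → t′ ⊑ s′ → (t ⊔ᵗ t′) ⊑ (s ⊔ᵗ s′)
⊔-mono 𝟙 s′ p q _ = cong (_⊔ᵗ _) (p λ ())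
⊔-mono 𝟘 s′ p q r = cong₂ _⊔ᵗ_ (p λ ()) (q r)
⊔-mono {t} 𝐮 𝟙 p q _ = trans (cong (t ⊔ᵗ_) (q λ ())) (⊔ᵗ-zeroʳ t)
⊔-mono 𝐮 𝐮 p q r = contradiction refl r
⊔-mono 𝐮 𝟘 p q r = contradiction refl r

⊓≡𝟙 : ∀ s t → s ⊓ᵗ t ≡ 𝟙 → s ≡ 𝟙 × t ≡ 𝟙
⊓≡𝟙 𝟙 𝟙 _ = refl , refl
⊓≡𝟙 𝐮 𝟘 ()
⊓≡𝟙 𝐮 𝐮 ()
⊓≡𝟙 𝐮 𝟙 ()

⊔≡𝟘 : ∀ s t → s ⊔ᵗ t ≡ 𝟘 → s ≡ 𝟘 × t ≡ 𝟘
⊔≡𝟘 𝟘 𝟘 _ = refl , refl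
⊔≡𝟘 𝐮 𝟘 ()
⊔≡𝟘 𝐮 𝐮 ()
⊔≡𝟘 𝐮 𝟙 ()

⊓≡𝟘 : ∀ s t → s ⊓ᵗ t ≡ 𝟘 → s ≢ 𝟘 → t ≡ 𝟘
⊓≡𝟘 𝟘 t _ s≢𝟘 = contradiction refl s≢𝟘
⊓≡𝟘 𝐮 𝟘 _ _ = refl
⊓≡𝟘 𝟙 t e _ = e

⊔≡𝟙 : ∀ s t → s ⊔ᵗ t ≡ 𝟙 → s ≢ 𝟙 → t ≡ 𝟙
⊔≡𝟙 𝟙 t _ s≢𝟙 = contradiction refl s≢𝟙
⊔≡𝟙 𝐮 𝟙 _ _ = refl
⊔≡𝟙 𝟘 t e _ = e

separates⇒complementary : ∀ (α β : Vec Trit n) i → Separates α β i → lookup β i ≡ ~ lookup α i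
separates⇒complementary α β i = go (lookup α i) (lookup β i)
  where
  go : ∀ s t → s ≢ t × s ≢ 𝐮 × t ≢ 𝐮 → t ≡ ~ s
  go 𝟘 𝟘 (s≢t , _) = contradiction refl s≢t
  go 𝟙 𝟙 (s≢t , _) = contradiction refl s≢t
  go 𝟘 𝟙 _ = refl
  go 𝟙 𝟘 _ = refl
  go 𝐮 t (_ , s≢𝐮 , _) = contradiction refl s≢𝐮
  go 𝟘 𝐮 (_ , _ , t≢𝐮) = contradiction refl t≢𝐮
  go 𝟙 𝐮 (_ , _ , t≢𝐮) = contradiction refl t≢𝐮

separates-sym : ∀ {α β : Vec Trit n} i → Separates α β i → Separates β α i
separates-sym i (α≢β , α≢𝐮 , β≢𝐮) = α≢β ∘ sym , β≢𝐮 , α≢𝐮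

-- Evaluation at resolutions and hazard-freeness.

eval-resolution : ∀ (F : Formula n) {a α} → a ResolutionOf α →
                  eval F (Vec.map ⌜_⌝ a) ⊑ eval F α
eval-resolution (var i) {a} r α≢𝐮 = trans (lookup-map i ⌜_⌝ a) (r i α≢𝐮)
eval-resolution (¬var i) {a} {α} r =
  ~-mono {s = lookup α i} (λ α≢𝐮 → trans (lookup-map i ⌜_⌝ a) (r i α≢𝐮))
eval-resolution (F ∧ G) {α = α} r =
  ⊓-mono (eval F α) (eval G α) (eval-resolution F r) (eval-resolution G r)
eval-resolution (F ∨ G) {α = α} r =
  ⊔-mono (eval F α) (eval G α) (eval-resolution F r) (eval-resolution G r)

resolution : (α : Vec Trit n) → ∃[ a ] a ResolutionOf α
resolution [] = [] , λ ()
resolution (t ∷ α) = let a , r = resolution α in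
  choose t ∷ a , λ { Fin.zero → choose-sound t ; (Fin.suc i) → r i }
  where
  choose : Trit → Bool
  choose 𝟘 = false
  choose 𝐮 = false
  choose 𝟙 = true

  choose-sound : ∀ t → ⌜ choose t ⌝ ⊑ t
  choose-sound 𝟘 _ = refl
  choose-sound 𝐮 𝐮≢𝐮 = contradiction refl 𝐮≢𝐮
  choose-sound 𝟙 _ = refl

-- `extValue` tries `true` first, so for `c = false` that test must be shown to fail; a resolution
-- of `α`, where `f` would take both values, does this.
constant⇒ext : ∀ (f : BoolFun n) α c → ConstantOn f α c → hazardFreeExt f α ≡ ⌜ c ⌝
constant⇒ext f α true const with constantOn? f α true
... | yes _ = refl
... | no ¬const = contradiction const ¬const
constant⇒ext f α false const with constantOn? f α true | constantOn? f α false
... | yes const′ | _ = let a , r = resolution α in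
  contradiction (trans (sym (const′ a r)) (const a r)) λ ()
... | no _ | yes _ = refl
... | no _ | no ¬const = contradiction const ¬const

-- A Boolean string is its own only resolution.
ext-Boolean : ∀ (f : BoolFun n) a → hazardFreeExt f (Vec.map ⌜_⌝ a) ≡ ⌜ f a ⌝
ext-Boolean f a = constant⇒ext f (Vec.map ⌜_⌝ a) (f a) λ b r → cong f (Pointwise-≡⇒≡ (ext λ i →
  ⌜⌝-injective (trans (r i (⌜⌝≢𝐮 _ ∘ trans (sym (lookup-map i ⌜_⌝ a)))) (lookup-map i ⌜_⌝ a))))

extends⇒hazardFree : ∀ {f : BoolFun n} {F} →
                     (∀ α → eval F α ≡ hazardFreeExt f α) → F HazardFreeFor f
extends⇒hazardFree {f = f} extends = (λ a → trans (extends _) (ext-Boolean f a)) , extends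

-- If `eval F α` is Boolean, it is also the value of `F` at each resolution `a`, where the
-- hypothesis identifies it with `f a`; so `f` is constant on the resolutions of `α`. If `eval F α`
-- is `𝐮`, the hypothesis forbids a Boolean value of the extension.
hazardFree-if-Boolean : ∀ {f : BoolFun n} {F} →
  (∀ α c → hazardFreeExt f α ≡ ⌜ c ⌝ → eval F α ≡ ⌜ c ⌝) → F HazardFreeFor f
hazardFree-if-Boolean {n} {f} {F} agrees = extends⇒hazardFree {F = F} extends
  where
  constant : ∀ α c → eval F α ≡ ⌜ c ⌝ → ConstantOn f α c
  constant α c Fα≡c a r = ⌜⌝-injective (begin
    ⌜ f a ⌝                ≡⟨ agrees _ (f a) (ext-Boolean f a) ⟨
    eval F (Vec.map ⌜_⌝ a) ≡⟨ eval-resolution F r (⌜⌝≢𝐮 c ∘ trans (sym Fα≡c)) ⟩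
    eval F α               ≡⟨ Fα≡c ⟩
    ⌜ c ⌝                  ∎)
    where open ≡-Reasoning

  extends : ∀ α → eval F α ≡ hazardFreeExt f α
  extends α with eval F α in Fα
  ... | 𝟘 = sym (constant⇒ext f α false (constant α false Fα))
  ... | 𝟙 = sym (constant⇒ext f α true (constant α true Fα))
  ... | 𝐮 with hazardFreeExt f α in fα
  ...   | 𝟘 = trans (sym Fα) (agrees α false fα)
  ...   | 𝐮 = refl
  ...   | 𝟙 = trans (sym Fα) (agrees α true fα)

-- Bounds on the bits and splitting by a message.

protocolDepth : ∀ {A B O} → Protocol A B O → ℕ
protocolDepth (leaf _)      = 0
protocolDepth (alice _ Π Ρ) = suc (protocolDepth Π ⊔ protocolDepth Ρ)
protocolDepth (bob _ Π Ρ)   = suc (protocolDepth Π ⊔ protocolDepth Ρ)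

bits≤protocolDepth : ∀ {A B O} (Π : Protocol A B O) x y → bits Π x y ≤ protocolDepth Π
bits≤protocolDepth (leaf _) x y = z≤n
bits≤protocolDepth (alice m Π Ρ) x y with m x
... | true  = s≤s (m≤n⇒m≤o⊔n _ (bits≤protocolDepth Ρ x y))
... | false = s≤s (m≤n⇒m≤n⊔o _ (bits≤protocolDepth Π x y))
bits≤protocolDepth (bob m Π Ρ) x y with m y
... | true  = s≤s (m≤n⇒m≤o⊔n _ (bits≤protocolDepth Ρ x y))
... | false = s≤s (m≤n⇒m≤n⊔o _ (bits≤protocolDepth Π x y))

_sends_ : ∀ {X : Set} → (X → Bool) → Bool → X → Set
(m sends c) x = m x ≡ c

splitBy : ∀ {X : Set} (P : X → Set) (m : X → Bool) →
          P ⊆ (P ∩ m sends false) ∪ (P ∩ m sends true)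
splitBy P m {x} px with m x
... | false = inj₁ (px , refl)
... | true  = inj₂ (px , refl)

-- From formulas to protocols.

module _ {A B : Set} (a : A → Vec Trit n) (b : B → Vec Trit n) where

  -- Bob's bit tells whether the left conjunct is already `𝟘` on his input, Alice's whether the left
  -- disjunct is already `𝟙` on hers. The bit `true` selects the second subtree, hence `G` comes
  -- first.
  protocol : Formula n → Protocol A B (Fin n)
  protocol (var i)  = leaf i
  protocol (¬var i) = leaf i
  protocol (F ∧ G)  = bob   (λ y → does (eval F (b y) ≟ᵗ 𝟘)) (protocol G) (protocol F)
  protocol (F ∨ G)  = alice (λ x → does (eval F (a x) ≟ᵗ 𝟙)) (protocol G) (protocol F)

  protocol-leaves : ∀ F → leaves (protocol F) ≡ size F
  protocol-leaves (var i)  = refl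
  protocol-leaves (¬var i) = refl
  protocol-leaves (F ∧ G)  =
    trans (+-comm (leaves (protocol G)) _) (cong₂ _+_ (protocol-leaves F) (protocol-leaves G))
  protocol-leaves (F ∨ G)  =
    trans (+-comm (leaves (protocol G)) _) (cong₂ _+_ (protocol-leaves F) (protocol-leaves G))

  protocol-bits : ∀ F x y → bits (protocol F) x y ≤ depth F
  protocol-bits (var i)  x y = z≤n
  protocol-bits (¬var i) x y = z≤n
  protocol-bits (F ∧ G)  x y with does (eval F (b y) ≟ᵗ 𝟘)
  ... | true  = s≤s (m≤n⇒m≤n⊔o _ (protocol-bits F x y))
  ... | false = s≤s (m≤n⇒m≤o⊔n _ (protocol-bits G x y))
  protocol-bits (F ∨ G)  x y with does (eval F (a x) ≟ᵗ 𝟙)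
  ... | true  = s≤s (m≤n⇒m≤n⊔o _ (protocol-bits F x y))
  ... | false = s≤s (m≤n⇒m≤o⊔n _ (protocol-bits G x y))

  -- The two evaluations are the invariant of the descent. At `F ∧ G` both conjuncts are `𝟙` for
  -- Alice, and Bob moves to one that is `𝟘`: if `F` is not, the minimum forces `G` to be. The case
  -- of `∨` is dual.
  protocol-separates : ∀ F x y → eval F (a x) ≡ 𝟙 → eval F (b y) ≡ 𝟘 →
                       Separates (a x) (b y) (output (protocol F) x y)
  protocol-separates (var i) x y p q rewrite p | q = (λ ()) , (λ ()) , (λ ())
  protocol-separates (¬var i) x y p q with lookup (a x) i | lookup (b y) i
  protocol-separates (¬var i) x y refl refl | 𝟘 | 𝟙 = (λ ()) , (λ ()) , (λ ())
  protocol-separates (F ∧ G) x y p q with ⊓≡𝟙 (eval F (a x)) _ p | eval F (b y) ≟ᵗ 𝟘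
  ... | pF , _ | yes qF = protocol-separates F x y pF qF
  ... | _ , pG | no ¬qF = protocol-separates G x y pG (⊓≡𝟘 _ _ q ¬qF)
  protocol-separates (F ∨ G) x y p q with ⊔≡𝟘 (eval F (b y)) _ q | eval F (a x) ≟ᵗ 𝟙
  ... | qF , _ | yes pF = protocol-separates F x y pF qF
  ... | _ , qG | no ¬pF = protocol-separates G x y (⊔≡𝟙 _ _ p ¬pF) qG

  -- Formulas separating the two sides of a rectangle.

  record SeparatedBy (P : A → Set) (Q : B → Set) (F : Formula n) : Set where
    constructor separates
    field
      on-alice : ∀ {x} → P x → eval F (a x) ≡ 𝟙
      on-bob   : ∀ {y} → Q y → eval F (b y) ≡ 𝟘

  -- Alice's inputs may be divided between the disjuncts, since one `𝟙` makes the maximum `𝟙`; for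
  -- Bob both disjuncts must be `𝟘` on all of `Q`.
  ∨-separatedBy : ∀ {P P₁ P₂ Q F G} → P ⊆ P₁ ∪ P₂ →
                  SeparatedBy P₁ Q F → SeparatedBy P₂ Q G → SeparatedBy P Q (F ∨ G)
  ∨-separatedBy cover (separates F𝟙 F𝟘) (separates G𝟙 G𝟘) = separates
    (λ px → [ (λ p₁ → cong (_⊔ᵗ _) (F𝟙 p₁))
            , (λ p₂ → trans (cong (_ ⊔ᵗ_) (G𝟙 p₂)) (⊔ᵗ-zeroʳ _)) ]′ (cover px))
    (λ qy → cong₂ _⊔ᵗ_ (F𝟘 qy) (G𝟘 qy))

  ∧-separatedBy : ∀ {P Q Q₁ Q₂ F G} → Q ⊆ Q₁ ∪ Q₂ →
                  SeparatedBy P Q₁ F → SeparatedBy P Q₂ G → SeparatedBy P Q (F ∧ G)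
  ∧-separatedBy cover (separates F𝟙 F𝟘) (separates G𝟙 G𝟘) = separates
    (λ px → cong₂ _⊓ᵗ_ (F𝟙 px) (G𝟙 px))
    (λ qy → [ (λ q₁ → cong (_⊓ᵗ _) (F𝟘 q₁))
            , (λ q₂ → trans (cong (_ ⊓ᵗ_) (G𝟘 q₂)) (⊓ᵗ-zeroʳ _)) ]′ (cover qy))

  SeparableWithin : (A → Set) → (B → Set) → ℕ → ℕ → Set
  SeparableWithin P Q s d = ∃[ F ] SeparatedBy P Q F × size F ≤ s × depth F ≤ d

  -- Every `x` in `P` is opposite at `i` to the one point `y₀`, and every `y` in `Q` to `x₀`, so
  -- coordinate `i` has one Boolean value on `P` and the other on `Q`. The value at `x₀` decides the
  -- sign of the literal.
  separatingLiteral : ∀ {P Q} i → ∃ P → ∃ Q →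
    (∀ {x y} → P x → Q y → Separates (a x) (b y) i) →
    ∃[ F ] SeparatedBy P Q F × size F ≡ 1 × depth F ≡ 0
  separatingLiteral {P} {Q} i (x₀ , px₀) (y₀ , qy₀) sep =
    literal (lookup (a x₀) i) (proj₁ (proj₂ (sep px₀ qy₀))) at-x at-y
    where
    at-y : ∀ {y} → Q y → lookup (b y) i ≡ ~ lookup (a x₀) i
    at-y qy = separates⇒complementary (a x₀) (b _) i (sep px₀ qy)

    at-x : ∀ {x} → P x → lookup (a x) i ≡ ~ ~ lookup (a x₀) i
    at-x px = trans
      (separates⇒complementary (b y₀) (a _) i (separates-sym {α = a _} {b y₀} i (sep px qy₀)))
      (cong ~_ (at-y qy₀))

    literal : ∀ t → t ≢ 𝐮 →
      (∀ {x} → P x → lookup (a x) i ≡ ~ ~ t) → (∀ {y} → Q y → lookup (b y) i ≡ ~ t) →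
      ∃[ F ] SeparatedBy P Q F × size F ≡ 1 × depth F ≡ 0
    literal 𝟘 _ at-x at-y = ¬var i , separates (cong ~_ ∘ at-x) (cong ~_ ∘ at-y) , refl , refl
    literal 𝟙 _ at-x at-y = var i , separates at-x at-y , refl , refl
    literal 𝐮 𝐮≢𝐮 _ _ = contradiction refl 𝐮≢𝐮

  -- Existence of a separating formula.

  module _ (separable : ∀ x y → ∃ (Separates (a x) (b y))) where

    -- A conjunction with one literal for each listed input of Bob. The head `y` is kept apart from
    -- `ys` because an empty conjunction would need a constant, which the grammar lacks.
    separatePoint : ∀ x y ys → ∃ (SeparatedBy (_≡ x) (_∈ (y ∷ ys)))
    separatePoint x y [] =
      let i , sep = separable x y
          F , sepF , _ = separatingLiteral {Q = _∈ (y ∷ [])} i (x , refl) (y , here refl)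
            λ { refl (here refl) → sep }
      in F , sepF
    separatePoint x y (y′ ∷ ys) =
      let F , sepF = separatePoint x y []
          G , sepG = separatePoint x y′ ys
      in F ∧ G , ∧-separatedBy (λ { (here refl) → inj₁ (here refl) ; (there y∈) → inj₂ y∈ })
                   sepF sepG

    -- The result is a disjunctive normal form with one clause per listed input of Alice.
    separateLists : ∀ x xs y ys → ∃ (SeparatedBy (_∈ (x ∷ xs)) (_∈ (y ∷ ys)))
    separateLists x [] y ys =
      let F , separates F𝟙 F𝟘 = separatePoint x y ys
      in F , separates (λ { (here refl) → F𝟙 refl }) F𝟘
    separateLists x (x′ ∷ xs) y ys =
      let F , sepF = separatePoint x y ys
          G , sepG = separateLists x′ xs y ys
      in F ∨ G , ∨-separatedBy (λ { (here refl) → inj₁ refl ; (there x∈) → inj₂ x∈ }) sepF sepG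

  -- From protocols to formulas.

  module _ (anyA? : {P : A → Set} → Decidable P → Dec (∃ P))
           (anyB? : {Q : B → Set} → Decidable Q → Dec (∃ Q)) where

    -- Induction on `Π`, with `P` and `Q` the sides of the rectangle of inputs that reach it and `d`
    -- the bits left to spend. Both sides stay inhabited, since a leaf needs sample points to choose
    -- its literal and an empty rectangle would make the cost bound vacuous. Decidability lets each
    -- half of a split be tested for emptiness.
    separatingFormula : ∀ Π {P Q} d → Decidable P → Decidable Q → ∃ P → ∃ Q →
      (∀ {x y} → P x → Q y → Separates (a x) (b y) (output Π x y)) →
      (∀ {x y} → P x → Q y → bits Π x y ≤ d) →
      SeparableWithin P Q (leaves Π) d
    separatingFormula (leaf i) d P? Q? x₀ y₀ sep _ =
      let F , sepF , size≡ , depth≡ = separatingLiteral i x₀ y₀ sep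
      in F , sepF , ≤-reflexive size≡ , ≤-trans (≤-reflexive depth≡) z≤n
    -- Some pair in the rectangle spends a bit at this node, so the budget cannot be zero.
    separatingFormula (alice m Π Ρ) zero P? Q? (_ , px₀) (_ , qy₀) sep cost =
      contradiction (cost px₀ qy₀) λ ()
    separatingFormula (alice m Π Ρ) {P} {Q} (suc d) P? Q? x₀ y₀ sep cost = combine
      (anyA? λ x → P? x ×-dec (m x Bool.≟ false)) (anyA? λ x → P? x ×-dec (m x Bool.≟ true))
      where
      left : ∃ (P ∩ m sends false) → SeparableWithin (P ∩ m sends false) Q (leaves Π) d
      left x = separatingFormula Π d (λ x → P? x ×-dec (m x Bool.≟ false)) Q? x y₀ sep′ cost′
        where
        sep′ : ∀ {x y} → (P ∩ m sends false) x → Q y → Separates (a x) (b y) (output Π x y)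
        sep′ {x} {y} (px , e) qy with m x | e | sep px qy
        ... | false | refl | s = s

        cost′ : ∀ {x y} → (P ∩ m sends false) x → Q y → bits Π x y ≤ d
        cost′ {x} {y} (px , e) qy with m x | e | cost px qy
        ... | false | refl | s≤s k = k

      right : ∃ (P ∩ m sends true) → SeparableWithin (P ∩ m sends true) Q (leaves Ρ) d
      right x = separatingFormula Ρ d (λ x → P? x ×-dec (m x Bool.≟ true)) Q? x y₀ sep′ cost′
        where
        sep′ : ∀ {x y} → (P ∩ m sends true) x → Q y → Separates (a x) (b y) (output Ρ x y)
        sep′ {x} {y} (px , e) qy with m x | e | sep px qy
        ... | true | refl | s = s

        cost′ : ∀ {x y} → (P ∩ m sends true) x → Q y → bits Ρ x y ≤ d
        cost′ {x} {y} (px , e) qy with m x | e | cost px qy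
        ... | true | refl | s≤s k = k

      combine : Dec (∃ (P ∩ m sends false)) → Dec (∃ (P ∩ m sends true)) →
                SeparableWithin P Q (leaves Π + leaves Ρ) (suc d)
      combine (yes x₁) (yes x₂) =
        let F , sepF , sizeF , depthF = left x₁
            G , sepG , sizeG , depthG = right x₂
        in F ∨ G , ∨-separatedBy (splitBy P m) sepF sepG , +-mono-≤ sizeF sizeG ,
           s≤s (⊔-lub depthF depthG)
      -- All of `P` sends `true`: the node is dropped and the formula for `Ρ` taken over, within
      -- weaker bounds.
      combine (no none) _ =
        let to : P ⊆ (P ∩ m sends true)
            to p = [ (λ p′ → contradiction (_ , p′) none) , id ]′ (splitBy P m p)
            F , separates F𝟙 F𝟘 , sizeF , depthF = right (map₂ to x₀)
        in F , separates (F𝟙 ∘ to) F𝟘 , m≤n⇒m≤o+n (leaves Π) sizeF , m≤n⇒m≤1+n depthF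
      combine _ (no none) =
        let to : P ⊆ (P ∩ m sends false)
            to p = [ id , (λ p′ → contradiction (_ , p′) none) ]′ (splitBy P m p)
            F , separates F𝟙 F𝟘 , sizeF , depthF = left (map₂ to x₀)
        in F , separates (F𝟙 ∘ to) F𝟘 , m≤n⇒m≤n+o (leaves Ρ) sizeF , m≤n⇒m≤1+n depthF
    separatingFormula (bob m Π Ρ) zero P? Q? (_ , px₀) (_ , qy₀) sep cost =
      contradiction (cost px₀ qy₀) λ ()
    -- Dual to Alice's node: `Q` is split, and `∧` joins the halves.
    separatingFormula (bob m Π Ρ) {P} {Q} (suc d) P? Q? x₀ y₀ sep cost = combine
      (anyB? λ y → Q? y ×-dec (m y Bool.≟ false)) (anyB? λ y → Q? y ×-dec (m y Bool.≟ true))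
      where
      left : ∃ (Q ∩ m sends false) → SeparableWithin P (Q ∩ m sends false) (leaves Π) d
      left y = separatingFormula Π d P? (λ y → Q? y ×-dec (m y Bool.≟ false)) x₀ y sep′ cost′
        where
        sep′ : ∀ {x y} → P x → (Q ∩ m sends false) y → Separates (a x) (b y) (output Π x y)
        sep′ {x} {y} px (qy , e) with m y | e | sep px qy
        ... | false | refl | s = s

        cost′ : ∀ {x y} → P x → (Q ∩ m sends false) y → bits Π x y ≤ d
        cost′ {x} {y} px (qy , e) with m y | e | cost px qy
        ... | false | refl | s≤s k = k

      right : ∃ (Q ∩ m sends true) → SeparableWithin P (Q ∩ m sends true) (leaves Ρ) d
      right y = separatingFormula Ρ d P? (λ y → Q? y ×-dec (m y Bool.≟ true)) x₀ y sep′ cost′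
        where
        sep′ : ∀ {x y} → P x → (Q ∩ m sends true) y → Separates (a x) (b y) (output Ρ x y)
        sep′ {x} {y} px (qy , e) with m y | e | sep px qy
        ... | true | refl | s = s

        cost′ : ∀ {x y} → P x → (Q ∩ m sends true) y → bits Ρ x y ≤ d
        cost′ {x} {y} px (qy , e) with m y | e | cost px qy
        ... | true | refl | s≤s k = k

      combine : Dec (∃ (Q ∩ m sends false)) → Dec (∃ (Q ∩ m sends true)) →
                SeparableWithin P Q (leaves Π + leaves Ρ) (suc d)
      combine (yes y₁) (yes y₂) =
        let F , sepF , sizeF , depthF = left y₁
            G , sepG , sizeG , depthG = right y₂
        in F ∧ G , ∧-separatedBy (splitBy Q m) sepF sepG , +-mono-≤ sizeF sizeG ,
           s≤s (⊔-lub depthF depthG)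
      combine (no none) _ =
        let to : Q ⊆ (Q ∩ m sends true)
            to p = [ (λ p′ → contradiction (_ , p′) none) , id ]′ (splitBy Q m p)
            F , separates F𝟙 F𝟘 , sizeF , depthF = right (map₂ to y₀)
        in F , separates F𝟙 (F𝟘 ∘ to) , m≤n⇒m≤o+n (leaves Π) sizeF , m≤n⇒m≤1+n depthF
      combine _ (no none) =
        let to : Q ⊆ (Q ∩ m sends false)
            to p = [ id , (λ p′ → contradiction (_ , p′) none) ]′ (splitBy Q m p)
            F , separates F𝟙 F𝟘 , sizeF , depthF = left (map₂ to y₀)
        in F , separates F𝟙 (F𝟘 ∘ to) , m≤n⇒m≤n+o (leaves Ρ) sizeF , m≤n⇒m≤1+n depthF

-- Enumeration of inputs and formulas.

strings : ∀ n → List (Vec Trit n)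
strings zero    = [] ∷ []
strings (suc n) = cartesianProductWith _∷_ (𝟘 ∷ 𝐮 ∷ 𝟙 ∷ []) (strings n)

strings-complete : (α : Vec Trit n) → α ∈ strings n
strings-complete []      = here refl
strings-complete (t ∷ α) = ∈-cartesianProductWith⁺ _∷_ (trit t) (strings-complete α)
  where
  trit : ∀ t → t ∈ 𝟘 ∷ 𝐮 ∷ 𝟙 ∷ []
  trit 𝟘 = here refl
  trit 𝐮 = there (here refl)
  trit 𝟙 = there (there (here refl))

module _ (g : Vec Trit n → Trit) (t : Trit) where

  fibreAt : ∀ α → Dec (g α ≡ t) → List (∃[ β ] g β ≡ t)
  fibreAt α (yes p) = (α , p) ∷ []
  fibreAt α (no _)  = []

  fibre : List (∃[ β ] g β ≡ t)
  fibre = List.concatMap (λ α → fibreAt α (g α ≟ᵗ t)) (strings n)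

  fibre-complete : ∀ x → x ∈ fibre
  fibre-complete (α , p) = ∈-concatMap⁺ _ (lose (strings-complete α) (∈-fibreAt (g α ≟ᵗ t)))
    where
    ∈-fibreAt : ∀ p? → (α , p) ∈ fibreAt α p?
    -- The list stores the proof `q` found by the test, while membership is asked for `p`; equality
    -- proofs in `Trit` are unique.
    ∈-fibreAt (yes q) = here (cong (α ,_) (Decidable⇒UIP.≡-irrelevant _≟ᵗ_ p q))
    ∈-fibreAt (no ¬p) = contradiction p ¬p

literals : ∀ n → List (Formula n)
literals n = List.map var (allFin n) ++ List.map ¬var (allFin n)

-- Literals return at every level because the two subformulas of a gate may differ in depth.
formulas : ∀ n → ℕ → List (Formula n)
formulas n zero    = literals n
formulas n (suc d) = literals n ++
  cartesianProductWith _∧_ (formulas n d) (formulas n d) ++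
  cartesianProductWith _∨_ (formulas n d) (formulas n d)

literals⊆formulas : ∀ d → {F : Formula n} → F ∈ literals n → F ∈ formulas n d
literals⊆formulas zero    = id
literals⊆formulas (suc d) = ∈-++⁺ˡ

formulas-complete : ∀ d (F : Formula n) → depth F ≤ d → F ∈ formulas n d
formulas-complete d (var i)  _ = literals⊆formulas d (∈-++⁺ˡ (∈-map⁺ var (∈-allFin i)))
formulas-complete d (¬var i) _ = literals⊆formulas d (∈-++⁺ʳ _ (∈-map⁺ ¬var (∈-allFin i)))
formulas-complete {n} (suc d) (F ∧ G) (s≤s F⊔G≤d) = ∈-++⁺ʳ (literals n) (∈-++⁺ˡ
  (∈-cartesianProductWith⁺ _∧_ (formulas-complete d F (m⊔n≤o⇒m≤o _ _ F⊔G≤d))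
                               (formulas-complete d G (m⊔n≤o⇒n≤o _ _ F⊔G≤d))))
formulas-complete {n} (suc d) (F ∨ G) (s≤s F⊔G≤d) = ∈-++⁺ʳ (literals n) (∈-++⁺ʳ _
  (∈-cartesianProductWith⁺ _∨_ (formulas-complete d F (m⊔n≤o⇒m≤o _ _ F⊔G≤d))
                               (formulas-complete d G (m⊔n≤o⇒n≤o _ _ F⊔G≤d))))

size≥1 : ∀ (F : Formula n) → 1 ≤ size F
size≥1 (var _)  = s≤s z≤n
size≥1 (¬var _) = s≤s z≤n
size≥1 (F ∧ G)  = m≤n⇒m≤n+o _ (size≥1 F)
size≥1 (F ∨ G)  = m≤n⇒m≤n+o _ (size≥1 F)

-- One leaf of the other subformula pays for the gate.
suc-⊔<+ : ∀ {k l m n} → 1 ≤ m → 1 ≤ n → k < m → l < n → suc (k ⊔ l) < m + n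
suc-⊔<+ {k} {m = m} {n} 1≤m 1≤n k<m l<n =
  ⊔-lub (subst (suc (suc k) ≤_) (+-comm n m) (+-mono-≤ 1≤n k<m)) (+-mono-≤ 1≤m l<n)

-- Allows the enumeration by depth to exhaust the formulas of a given size.
depth<size : ∀ (F : Formula n) → depth F < size F
depth<size (var _)  = s≤s z≤n
depth<size (¬var _) = s≤s z≤n
depth<size (F ∧ G)  = suc-⊔<+ (size≥1 F) (size≥1 G) (depth<size F) (depth<size G)
depth<size (F ∨ G)  = suc-⊔<+ (size≥1 F) (size≥1 G) (depth<size F) (depth<size G)

-- Existence of the minima and the two equalities.

module _ (f : BoolFun n) where

  hazardFree? : ∀ F → Dec (F HazardFreeFor f)
  hazardFree? F = map′ (extends⇒hazardFree {F = F}) proj₂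
    (checkable strings-complete λ α → eval F α ≟ᵗ hazardFreeExt f α)

  -- The bound of `depth` by `μ` confines the formulas with `μ F ≡ k` to the finite list
  -- `formulas n k`, so it is decidable whether `k` is attained. Both measures, `depth` and `size`,
  -- are instances.
  minimum : ∃ (_HazardFreeFor f) → (μ : Formula n → ℕ) → (∀ F → depth F ≤ μ F) →
            ∃ (IsMinimum λ k → ∃[ F ] F HazardFreeFor f × μ F ≡ k)
  minimum (F , hf) μ depth≤μ = least attained? (μ F , F , hf , refl)
    where
    attained? : ∀ k → Dec (∃[ F ] F HazardFreeFor f × μ F ≡ k)
    attained? k = map′ Any.satisfied
      (λ { (F , hf , refl) → lose (formulas-complete k F (depth≤μ F)) (hf , refl) })
      (Any.any? (λ F → hazardFree? F ×-dec (μ F ≟ k)) (formulas n k))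

theorem4p6 : (n : ℕ) (f : BoolFun n) → NonConstant f →
    (∃[ d ] IsDepthᵘ f d × IsCC (KWᵘ f) d) ×
    (∃[ s ] IsSizeᵘ f s × IsMonorect (KWᵘ f) s)
theorem4p6 n f ((a₁ , fa₁≡true) , (a₀ , fa₀≡false)) = depths , sizes
  where
  open SearchProblem (KWᵘ f) using (AliceInput; BobInput)

  -- Non-constancy makes both sides of the game inhabited.
  x₀ : AliceInput
  x₀ = Vec.map ⌜_⌝ a₁ , trans (ext-Boolean f a₁) (cong ⌜_⌝ fa₁≡true)

  y₀ : BobInput
  y₀ = Vec.map ⌜_⌝ a₀ , trans (ext-Boolean f a₀) (cong ⌜_⌝ fa₀≡false)

  alices : List AliceInput
  alices = fibre (hazardFreeExt f) 𝟙

  alices-complete : ∀ x → x ∈ alices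
  alices-complete = fibre-complete (hazardFreeExt f) 𝟙

  bobs : List BobInput
  bobs = fibre (hazardFreeExt f) 𝟘

  bobs-complete : ∀ y → y ∈ bobs
  bobs-complete = fibre-complete (hazardFreeExt f) 𝟘

  separated⇒hazardFree : ∀ F →
    (∀ (x : AliceInput) → eval F (proj₁ x) ≡ 𝟙) → (∀ (y : BobInput) → eval F (proj₁ y) ≡ 𝟘) →
    F HazardFreeFor f
  separated⇒hazardFree F F𝟙 F𝟘 = hazardFree-if-Boolean {F = F} λ where
    α true  fα → F𝟙 (α , fα)
    α false fα → F𝟘 (α , fα)

  hazardFree-exists : ∃ (_HazardFreeFor f)
  hazardFree-exists =
    let F , separates F𝟙 F𝟘 = separateLists proj₁ proj₁ (SearchProblem.nonempty (KWᵘ f))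
                        x₀ alices y₀ bobs
    -- `x₀` and `y₀` were prefixed to make the lists nonempty; the complete lists are the tails,
    -- hence `there`.
    in F , separated⇒hazardFree F (λ x → F𝟙 (there (alices-complete x)))
                                  (λ y → F𝟘 (there (bobs-complete y)))

  formula→protocol : ∀ {F} → F HazardFreeFor f → Solves (KWᵘ f) (protocol proj₁ proj₁ F)
  formula→protocol {F} (_ , extends) x y = protocol-separates proj₁ proj₁ F x y
    (trans (extends _) (proj₂ x)) (trans (extends _) (proj₂ y))

  protocol→formula : ∀ {Π c} → Solves (KWᵘ f) Π → (∀ x y → bits Π x y ≤ c) →
                     ∃[ F ] F HazardFreeFor f × size F ≤ leaves Π × depth F ≤ c
  protocol→formula {Π} {c} solves bits≤c =
    let F , separates F𝟙 F𝟘 , size≤ , depth≤ =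
          separatingFormula proj₁ proj₁ (searchable alices-complete) (searchable bobs-complete)
            Π {U} {U} c U? U? (x₀ , tt) (y₀ , tt)
            (λ {x} {y} _ _ → solves x y) (λ {x} {y} _ _ → bits≤c x y)
    in F , separated⇒hazardFree F (λ x → F𝟙 {x} tt) (λ y → F𝟘 {y} tt) , size≤ , depth≤

  depths : ∃[ d ] IsDepthᵘ f d × IsCC (KWᵘ f) d
  depths = fromMinimum (minimum f hazardFree-exists depth (λ _ → ≤-refl))
   where
   fromMinimum : ∃ (IsDepthᵘ f) → ∃[ d ] IsDepthᵘ f d × IsCC (KWᵘ f) d
   fromMinimum (d , (F , hf , refl) , least-depth) =
    d , ((F , hf , refl) , least-depth) ,
    (Π , solves , attained , λ { k (x , y , refl) → bits≤d x y }) ,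
    -- A rival `Ρ` is charged for the bits actually exchanged, which is the budget that
    -- `protocol→formula` takes.
    λ { c (Ρ , solvesΡ , _ , bits≤c) → d≤cost solvesΡ λ x y → bits≤c _ (x , y , refl) }
    where
    Π : Protocol AliceInput BobInput (Fin n)
    Π = protocol proj₁ proj₁ F

    solves : Solves (KWᵘ f) Π
    solves = formula→protocol {F} hf

    bits≤d : ∀ x y → bits Π x y ≤ d
    bits≤d = protocol-bits proj₁ proj₁ F

    d≤cost : ∀ {Ρ c} → Solves (KWᵘ f) Ρ → (∀ x y → bits Ρ x y ≤ c) → d ≤ c
    d≤cost {Ρ} solvesΡ bits≤c =
      let G , hfG , _ , depth≤c = protocol→formula {Ρ} solvesΡ bits≤c
      in ≤-trans (least-depth _ (G , hfG , refl)) depth≤c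

    -- Otherwise Π would cost at most d - 1, giving a formula shallower than F.
    attained : ∃₂ λ x y → bits Π x y ≡ d
    attained = decidable-stable
      (searchable alices-complete λ x → searchable bobs-complete λ y → bits Π x y ≟ d)
      λ none →
        let bits<d : ∀ x y → bits Π x y < d
            bits<d x y = ≤∧≢⇒< (bits≤d x y) λ e → none (x , y , e)
        in ≰pred (bits<d x₀ y₀) (d≤cost {Π} solves λ x y → <⇒≤pred (bits<d x y))

  sizes : ∃[ s ] IsSizeᵘ f s × IsMonorect (KWᵘ f) s
  sizes = fromMinimum (minimum f hazardFree-exists size (<⇒≤ ∘ depth<size))
   where
   fromMinimum : ∃ (IsSizeᵘ f) → ∃[ s ] IsSizeᵘ f s × IsMonorect (KWᵘ f) s
   fromMinimum (s , (F , hf , size≡s) , least-size) =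
    s , ((F , hf , size≡s) , least-size) ,
    (protocol proj₁ proj₁ F , formula→protocol {F} hf ,
     trans (protocol-leaves proj₁ proj₁ F) size≡s) ,
    λ { _ (Ρ , solvesΡ , refl) →
      -- The leaf count puts no limit on the bits, so the full depth of the tree serves as the
      -- budget.
      let G , hfG , size≤ , _ = protocol→formula {Ρ} solvesΡ (bits≤protocolDepth Ρ)
      in ≤-trans (least-size _ (G , hfG , refl)) size≤ }
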